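{- Inner p-reflexivity fails in general: there exist a language $L$, an $L$-algebra $\mathfrak A$ with universe $A$, and elements $a,c\in A$ such that $a:a\not\approx_{\mathfrak A}c:c$.
   Context: Let $L$ be a language of algebras: a set of function symbols, each with an arity in $\mathbb N$ (constants are 0-ary function symbols). Fix a countably infinite set $X$ of variables; $T_{L,X}$ is the set of $L$-terms over $X$, and $X(s)$ denotes the set of variables occurring in a term $s$. For an $L$-algebra $\mathfrak A$ with universe $A$, every term $s$ induces a function $s^{\mathfrak A}$, evaluated at assignments of elements of $A$ to variables. An arrow of $\mathfrak A$ is a pair $(a,b)\in A\times A$, written $a\to b$. The generalizations of an arrow $a\to b$ in $\mathfrak A$ are the pairs of arbitrary terms $s\to t$ with $s,t\in T_{L,X}$ such that there is an assignment $\sigma$ of elements of $A$ to the variables in $X(s)\cup X(t)$ with $s^{\mathfrak A}(\sigma)=a$ and $t^{\mathfrak A}(\sigma)=b$; their set is denoted $\uparrow_{\mathfrak A}(a\to b)$. For $L$-algebras $\mathfrak A,\mathfrak B$, an arrow $a\to b$ of $\mathfrak A$ and an arrow $c\to d$ of $\mathfrak B$, set $(a\to b)\uparrow_{(\mathfrak A,\mathfrak B)}(c\to d):=\uparrow_{\mathfrak A}(a\to b)\cap\uparrow_{\mathfrak B}(c\to d)$. A pair of terms $s\to t$ is trivial in $(\mathfrak A,\mathfrak B)$ if it belongs to $\uparrow_{\mathfrak A}(e)$ for every arrow $e$ of $\mathfrak A$ and to $\uparrow_{\mathfrak B}(e')$ for every arrow $e'$ of $\mathfrak B$. We write $a\to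 b\lesssim_{(\mathfrak A,\mathfrak B)}c\to d$ iff either (i) every element of $\uparrow_{\mathfrak A}(a\to b)\cup\uparrow_{\mathfrak B}(c\to d)$ is trivial in $(\mathfrak A,\mathfrak B)$, or (ii) $(a\to b)\uparrow_{(\mathfrak A,\mathfrak B)}(c\to d)$ contains an element not trivial in $(\mathfrak A,\mathfrak B)$ and, for every arrow $c'\to d'$ of $\mathfrak B$, the inclusion $(a\to b)\uparrow_{(\mathfrak A,\mathfrak B)}(c\to d)\subseteq(a\to b)\uparrow_{(\mathfrak A,\mathfrak B)}(c'\to d')$ implies equality of these two sets. Define $a\to b\approx_{(\mathfrak A,\mathfrak B)}c\to d$ iff $a\to b\lesssim_{(\mathfrak A,\mathfrak B)}c\to d$ and $c\to d\lesssim_{(\mathfrak B,\mathfrak A)}a\to b$. For $a,b\in A$ and $c,d\in B$, the similarity-based analogical proportion $a:b\approx_{(\mathfrak A,\mathfrak B)}c:d$ holds iff $a\to b\approx_{(\mathfrak A,\mathfrak B)}c\to d$ and $b\to a\approx_{(\mathfrak A,\mathfrak B)}d\to c$. We write $\approx_{\mathfrak A}$ for $\approx_{(\mathfrak A,\mathfrak A)}$. -}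

module Defs where

open import Data.Nat using (ℕ)
open import Data.Product using (∃; _×_)
open import Data.Sum using (_⊎_)
open import Data.Vec using (Vec; []; _∷_)
open import Level using (0ℓ)
open import Relation.Binary.PropositionalEquality using (_≡_)
open import Relation.Unary using (Pred; _∈_; _∉_; _⊆_; _≐_; _∩_; _∪_)

record Language : Set₁ where
  field
    Symbol : Set
    arity  : Symbol → ℕ

open Language public

X : Set
X = ℕ

data Term (L : Language) : Set where
  var : X → Term L
  app : (f : Symbol L) → Vec (Term L) (arity L f) → Term L

record Algebra (L : Language) : Set₁ where
  field
    Carrier : Set
    op      : (f : Symbol L) → Vec Carrier (arity L f) → Carrier

open Algebra public

infix 6 _⟶_

record Arrow (A : Set) : Set where
  constructor _⟶_
  field
    source : A
    target : A

module _ {L : Language} where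

  -- Assignments are total on X rather than restricted to X(s) ∪ X(t).  The
  -- value of a term depends only on its own variables, and an algebra with an
  -- arrow is non-empty, so the generalizations below are the same.
  Assignment : Algebra L → Set
  Assignment 𝔄 = X → Carrier 𝔄

  module _ (𝔄 : Algebra L) where

    eval  : Term L → Assignment 𝔄 → Carrier 𝔄
    evals : ∀ {n} → Vec (Term L) n → Assignment 𝔄 → Vec (Carrier 𝔄) n

    eval (var x)    σ = σ x
    eval (app f ts) σ = op 𝔄 f (evals ts σ)

    evals []       σ = []
    evals (t ∷ ts) σ = eval t σ ∷ evals ts σ

    ↑ : Arrow (Carrier 𝔄) → Pred (Arrow (Term L)) 0ℓ
    ↑ (a ⟶ b) (s ⟶ t) = ∃ λ (σ : Assignment 𝔄) → eval s σ ≡ a × eval t σ ≡ b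

  module _ (𝔄 𝔅 : Algebra L) where

    ↑↑ : Arrow (Carrier 𝔄) → Arrow (Carrier 𝔅) → Pred (Arrow (Term L)) 0ℓ
    ↑↑ e e′ = ↑ 𝔄 e ∩ ↑ 𝔅 e′

    Trivial : Pred (Arrow (Term L)) 0ℓ
    Trivial g = (∀ e → g ∈ ↑ 𝔄 e) × (∀ e′ → g ∈ ↑ 𝔅 e′)

    _≲_ : Arrow (Carrier 𝔄) → Arrow (Carrier 𝔅) → Set
    e ≲ e′ =
      (↑ 𝔄 e ∪ ↑ 𝔅 e′) ⊆ Trivial
      ⊎
      (∃ λ g → g ∈ ↑↑ e e′ × g ∉ Trivial)
        × (∀ e″ → ↑↑ e e′ ⊆ ↑↑ e e″ → ↑↑ e e′ ≐ ↑↑ e e″)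

  ArrowSimilar : (𝔄 𝔅 : Algebra L) → Arrow (Carrier 𝔄) → Arrow (Carrier 𝔅) → Set
  ArrowSimilar 𝔄 𝔅 e e′ = _≲_ 𝔄 𝔅 e e′ × _≲_ 𝔅 𝔄 e′ e

  Proportion : (𝔄 𝔅 : Algebra L) (a b : Carrier 𝔄) (c d : Carrier 𝔅) → Set
  Proportion 𝔄 𝔅 a b c d =
    ArrowSimilar 𝔄 𝔅 (a ⟶ b) (c ⟶ d) × ArrowSimilar 𝔄 𝔅 (b ⟶ a) (d ⟶ c)

  infix 4 Proportion
  syntax Proportion 𝔄 𝔅 a b c d = a ∶ b ≈⟨ 𝔄 , 𝔅 ⟩ c ∶ d

{-# OPTIONS --safe #-}
module Submission where

open import Defs
open import Data.Bool using (Bool; true; false)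
open import Data.Product using (Σ; _,_; proj₁; proj₂)
open import Data.Sum using (inj₁; inj₂)
open import Data.Unit using (⊤; tt)
open import Data.Vec using ([])
open import Relation.Binary.PropositionalEquality using (refl)
open import Relation.Nullary using (¬_)
open import Relation.Unary using (_∈_; _∉_; _⊆_)

-- Within a single algebra, e itself is always a competitor of e′, and it shares
-- with e all generalizations of e.  So e ≲ e′ forces every generalization of e
-- to be one of e′; a constant symbol naming a but not c violates this.

≲⇒↑⊆↑ : ∀ {L} (𝔄 : Algebra L) {e e′} → _≲_ 𝔄 𝔄 e e′ → ↑ 𝔄 e ⊆ ↑ 𝔄 e′
-- A trivial generalization belongs to every arrow, in particular to `e′`.
≲⇒↑⊆↑ 𝔄 {e′ = e′} (inj₁ allTrivial) {g} g∈↑e = proj₁ (allTrivial {g} (inj₁ g∈↑e)) e′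
≲⇒↑⊆↑ 𝔄 {e = e} (inj₂ (_ , maximal)) {g} g∈↑e =
  -- Maximality against the competitor `e` gives an equality; its reverse inclusion puts
  -- `↑↑ 𝔄 𝔄 e e`, which is all of `↑ 𝔄 e`, inside `↑ 𝔄 e′`.
  proj₂ (proj₂ (maximal e λ (h∈↑e , _) → h∈↑e , h∈↑e) {g} (g∈↑e , g∈↑e))

pointedLanguage : Language
pointedLanguage = record { Symbol = ⊤ ; arity = λ _ → 0 }

pointedBool : Algebra pointedLanguage
pointedBool = record { Carrier = Bool ; op = λ _ _ → true }

point : Term pointedLanguage
point = app tt []

point∈↑true : (point ⟶ point) ∈ ↑ pointedBool (true ⟶ true)
point∈↑true = (λ _ → true) , refl , refl

point∉↑false : (point ⟶ point) ∉ ↑ pointedBool (false ⟶ false)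
-- The closed term `point` evaluates to `true` under every assignment.
point∉↑false (_ , () , _)

theorem3 : Σ Language λ L → Σ (Algebra L) λ 𝔄 → Σ (Carrier 𝔄) λ a → Σ (Carrier 𝔄) λ c →
    ¬ (a ∶ a ≈⟨ 𝔄 , 𝔄 ⟩ c ∶ c)
theorem3 = pointedLanguage , pointedBool , true , false ,
  -- The contradiction comes from `true ⟶ true` `≲` `false ⟶ false`.
  λ ((true≲false , _) , _) →
    point∉↑false (≲⇒↑⊆↑ pointedBool true≲false {point ⟶ point} point∈↑true)
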